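{- Let $\mathcal{G}_1$ and $\mathcal{G}_2$ be two maximal ancestral graphs (MAGs) on the same vertex set $\mathcal{V}$. Then $\mathcal{G}_1$ and $\mathcal{G}_2$ are Markov equivalent if and only if $\mathcal{S}(\mathcal{G}_1)=\mathcal{S}(\mathcal{G}_2)$.
   Context: An acyclic directed mixed graph (ADMG) $\mathcal{G}$ on a finite vertex set $\mathcal{V}$ has edges of two kinds, directed ($a\to b$) and bidirected ($a\leftrightarrow b$), and has no directed cycle. For $v\in\mathcal{V}$: $\mathrm{pa}_{\mathcal{G}}(v)=\{w: w\to v\}$; $\mathrm{sib}_{\mathcal{G}}(v)=\{w: w\leftrightarrow v\}$; $\mathrm{an}_{\mathcal{G}}(v)$ is $v$ together with all $w$ having a directed path $w\to\cdots\to v$; $\mathrm{de}_{\mathcal{G}}(v)$ is $v$ together with all $w$ having a directed path $v\to\cdots\to w$; $\mathrm{dis}_{\mathcal{G}}(v)$ (the district of $v$) is $v$ together with all $w$ joined to $v$ by a path consisting only of bidirected edges. For a set $W$ these operators are the union over $w\in W$. For $W\subseteq\mathcal{V}$, $\mathcal{G}_W$ is the induced subgraph on $W$ and $\mathrm{dis}_W(v)$ denotes the district of $v$ in $\mathcal{G}_W$ (union over elements for sets). A path is a sequence of distinct vertices in which consecutive vertices are joined by an edge. A non-endpoint vertex $w$ of a path is a collider on it if both path edges at $w$ have an arrowhead at $w$ (each is $\to w$ or $\leftrightarrow w$); otherwise it is a noncollider. For vertices $a,b$ and a set $C$ with $a,b\notin C$, a path between $a$ and $b$ is m-connecting given $C$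 if every noncollider on it is not in $C$ and every collider on it is in $\mathrm{an}_{\mathcal{G}}(C)$. For disjoint sets $A,B,C$ with $A,B$ nonempty, $A$ and $B$ are m-separated by $C$ if there is no m-connecting path given $C$ between any $a\in A$ and $b\in B$. Two vertices are adjacent if joined by an edge. $\mathcal{G}$ is maximal if every pair of nonadjacent vertices is m-separated by some set; it is ancestral if $\mathrm{sib}_{\mathcal{G}}(v)\cap\mathrm{an}_{\mathcal{G}}(v)=\emptyset$ for all $v$. A MAG is a maximal ancestral ADMG. Two graphs on the same vertex set are Markov equivalent if exactly the same m-separation statements hold in both. For $W\subseteq\mathcal{V}$, $\mathrm{barren}_{\mathcal{G}}(W)=\{w\in W:\mathrm{de}_{\mathcal{G}}(w)\cap W=\{w\}\}$. A set $H\subseteq\mathcal{V}$ is a head if $\mathrm{barren}_{\mathcal{G}}(H)=H$ and $H$ is contained in a single district of $\mathcal{G}_{\mathrm{an}_{\mathcal{G}}(H)}$; $\mathcal{H}(\mathcal{G})$ is the set of heads. The tail of a head is $\mathrm{tail}(H)=(\mathrm{dis}_{\mathrm{an}(H)}(H)\setminus H)\cup\mathrm{pa}_{\mathcal{G}}(\mathrm{dis}_{\mathrm{an}(H)}(H))$, where $\mathrm{an}(H)=\mathrm{an}_{\mathcal{G}}(H)$. The parametrizing set is $\mathcal{S}(\mathcal{G})=\{H\cup A: H\in\mathcal{H}(\mathcal{G}),\ A\subseteq\mathrm{tail}(H)\}$. -}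

module Defs where

open import Data.Nat using (ℕ)
open import Data.Bool using (Bool; true; false; _∧_)
open import Data.Fin using (Fin)
open import Data.Fin.Subset using (Subset; _∈_; _∉_; _∪_; Nonempty)
open import Data.List using (List; []; _∷_)
open import Data.List.Relation.Unary.All using (All)
open import Data.List.Relation.Unary.Unique.Propositional using (Unique)
open import Data.Product using (Σ; ∃; _×_; _,_)
open import Data.Sum using (_⊎_)
open import Data.Empty using (⊥)
open import Relation.Nullary using (¬_)
open import Relation.Binary.PropositionalEquality using (_≡_; _≢_)
open import Relation.Binary.Construct.Closure.ReflexiveTransitive using (Star)
open import Function.Bundles using (_⇔_)

-- Vertex set V = Fin n.  dir a b ≡ true  means  a → b ;  bi a b ≡ true  means  a ↔ b.
record ADMG (n : ℕ) : Set where
  field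
    dir    : Fin n → Fin n → Bool
    bi     : Fin n → Fin n → Bool
    bi-sym : ∀ a b → bi a b ≡ true → bi b a ≡ true
    bi-irr : ∀ a → bi a a ≡ false

module _ {n : ℕ} (G : ADMG n) where
  open ADMG G

  DirEdge : Fin n → Fin n → Set
  DirEdge a b = dir a b ≡ true

  Anc : Fin n → Fin n → Set
  Anc = Star DirEdge

  Acyclic : Set
  Acyclic = ∀ a b → dir a b ≡ true → ¬ Anc b a

  InAn : Subset n → Fin n → Set
  InAn C v = ∃ λ c → c ∈ C × Anc v c

  data Edge : Fin n → Fin n → Set where
    fwd : ∀ {u v} → dir u v ≡ true → Edge u v
    bwd : ∀ {u v} → dir v u ≡ true → Edge u v
    bid : ∀ {u v} → bi u v ≡ true → Edge u v

  headAtTgt : ∀ {u v} → Edge u v → Bool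
  headAtTgt (fwd _) = true
  headAtTgt (bwd _) = false
  headAtTgt (bid _) = true

  headAtSrc : ∀ {u v} → Edge u v → Bool
  headAtSrc (fwd _) = false
  headAtSrc (bwd _) = true
  headAtSrc (bid _) = true

  data Walk : Fin n → Fin n → Set where
    single : ∀ a → Walk a a
    step   : ∀ {a b c} → Edge a b → Walk b c → Walk a c

  vertices : ∀ {a b} → Walk a b → List (Fin n)
  vertices (single a) = a ∷ []
  vertices (step {a} e w) = a ∷ vertices w

  IsPath : ∀ {a b} → Walk a b → Set
  IsPath w = Unique (vertices w)

  -- non-endpoint vertices, each with (arrowhead from left edge, vertex, arrowhead from right edge)
  Triple : Set
  Triple = Bool × Fin n × Bool

  interiorFrom : ∀ {b c} → Bool → Walk b c → List Triple
  interiorFrom h (single _) = []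
  interiorFrom h (step {b} e w) = (h , b , headAtSrc e) ∷ interiorFrom (headAtTgt e) w

  interior : ∀ {a b} → Walk a b → List Triple
  interior (single _) = []
  interior (step e w) = interiorFrom (headAtTgt e) w

  OkGiven : Subset n → Triple → Set
  OkGiven C (l , v , r) with l ∧ r
  ... | true  = InAn C v
  ... | false = v ∉ C

  MConnecting : ∀ {a b} → Subset n → Walk a b → Set
  MConnecting C w = IsPath w × All (OkGiven C) (interior w)

  -- A and B are m-separated by C (disjointness / nonemptiness imposed where used)
  MSep : Subset n → Subset n → Subset n → Set
  MSep A B C = ∀ a b → a ∈ A → b ∈ B → (w : Walk a b) → ¬ MConnecting C w

  Adjacent : Fin n → Fin n → Set
  Adjacent a b = dir a b ≡ true ⊎ dir b a ≡ true ⊎ bi a b ≡ true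

  Maximal : Set
  Maximal = ∀ a b → a ≢ b → ¬ Adjacent a b →
            ∃ λ C → a ∉ C × b ∉ C × MSep (Data.Fin.Subset.⁅ a ⁆) (Data.Fin.Subset.⁅ b ⁆) C

  Ancestral : Set
  Ancestral = ∀ v w → bi v w ≡ true → ¬ Anc w v

  IsMAG : Set
  IsMAG = Acyclic × Maximal × Ancestral

  BiIn : (Fin n → Set) → Fin n → Fin n → Set
  BiIn W x y = W x × W y × bi x y ≡ true

  InDis : (Fin n → Set) → Fin n → Fin n → Set
  InDis W v w = W v × Star (BiIn W) v w

  InDisSet : (Fin n → Set) → Subset n → Fin n → Set
  InDisSet W H w = ∃ λ h → h ∈ H × InDis W h w

  Barren : Subset n → Set
  Barren H = ∀ h w → h ∈ H → w ∈ H → Anc h w → w ≡ h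

  IsHead : Subset n → Set
  IsHead H = Barren H × (∃ λ v → InAn H v × (∀ h → h ∈ H → InDis (InAn H) v h))

  InTail : Subset n → Fin n → Set
  InTail H w = (InDisSet (InAn H) H w × w ∉ H)
             ⊎ (∃ λ d → InDisSet (InAn H) H d × dir w d ≡ true)

  InS : Subset n → Set
  InS W = ∃ λ H → IsHead H × ∃ λ A → (∀ x → x ∈ A → InTail H x) × W ≡ H ∪ A

Disjoint : ∀ {n} → Subset n → Subset n → Set
Disjoint A B = ∀ x → x ∈ A → x ∉ B

MarkovEquivalent : ∀ {n} → ADMG n → ADMG n → Set
MarkovEquivalent {n} G₁ G₂ =
  ∀ (A B C : Subset n) → Nonempty A → Nonempty B →
    Disjoint A B → Disjoint A C → Disjoint B C →
    MSep G₁ A B C ⇔ MSep G₂ A B C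

{-# OPTIONS --safe #-}
module Submission where

-- A set W lies in S(G) iff its members all belong to, or are parents of, one district of an(W).
-- Hence two members of W are joined by a collider path inside an(W) and cannot be separated by any
-- set containing the rest of W; conversely, if W ∉ S(G), some barren h ∈ W is separated from some
-- x ∈ W by an(W) \ {h, x}.  So S(G) is determined by the separations of G.
--
-- For the converse, take a shortest walk π from a to b in G₂ with colliders in C and noncolliders
-- outside C.  Every noncollider k of π ends a discriminating path, which produces X ∋ k in S and a
-- neighbour w of k on π with X ∪ {w} ∉ S.  If π left an(a, b, C) of G₁, then at a vertex k ∉ an(a, b, C)
-- of π with no G₁-descendant on π the edge in G₁ would point w *→ k, forcing X ∪ {w} ∈ S.  So
-- π ⊆ an(a, b, C) in G₁; the segments of π between noncolliders are sets in S, so consecutive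
-- noncolliders are joined in G₁ by collider paths in an(a, b, C), and a, b are connected given C.

open import Defs
open import Data.Nat using (ℕ; suc; _+_; _≤_; _<_)
open import Data.Nat.Properties using (+-suc; +-comm; ≤-refl; ≤-trans; n≤1+n)
open import Data.Nat.Induction using (<-wellFounded)
open import Data.Bool using (Bool; true; false)
open import Data.Bool.Properties using () renaming (_≟_ to _≟ᵇ_)
open import Data.Fin using (Fin)
open import Data.Fin.Properties using (_≟_; any?; all?)
open import Data.Fin.Induction using (spo-noetherian)
open import Data.Fin.Subset using (Subset; _∈_; _∉_; _⊆_; _∪_; ⁅_⁆)
open import Data.Fin.Subset.Properties
  using (_∈?_; x∈⁅x⁆; x∈⁅y⁆⇒x≡y; ⊆-antisym; p⊆p∪q; q⊆p∪q; x∈p∪q⁻; x∈p∪q⁺; ∪-comm)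
open import Data.List using (List; []; _∷_; allFin)
open import Data.List.Relation.Unary.All using (All; []; _∷_)
open import Data.List.Relation.Unary.All.Properties using (¬Any⇒All¬)
open import Data.List.Relation.Unary.AllPairs using ([]; _∷_)
open import Data.List.Relation.Unary.Any using (here; there)
open import Data.List.Relation.Unary.Unique.Propositional using (Unique)
open import Data.List.Membership.DecPropositional using () renaming (_∈?_ to mem?)
open import Data.List.Membership.Propositional using () renaming (_∈_ to _∈ˡ_)
open import Data.List.Membership.Propositional.Properties using (∈-allFin)
open import Data.Product using (Σ; ∃; _×_; _,_; proj₁; proj₂)
open import Data.Sum as Sum using (_⊎_; inj₁; inj₂; [_,_]′)
open import Data.Empty using (⊥; ⊥-elim)
import Data.Vec as Vec
open import Data.Vec.Properties using (lookup∘tabulate; []=⇒lookup; lookup⇒[]=)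
open import Function using (_∘_; flip)
open import Function.Bundles using (_⇔_; mk⇔; Equivalence)
open import Function.Properties.Equivalence using () renaming (sym to ⇔-sym)
open import Induction.WellFounded using (WellFounded; Acc; acc)
open import Relation.Nullary using (¬_; yes; no; does; contradiction)
open import Relation.Nullary.Decidable
  using (map′; _×-dec_; _⊎-dec_; _→-dec_; ¬?; decidable-stable; dec-true)
open import Relation.Unary using () renaming (Decidable to Decidable₁)
open import Relation.Binary using (Decidable)
open import Relation.Binary.Structures using (IsStrictPartialOrder)
open import Relation.Binary.PropositionalEquality
  using (_≡_; _≢_; refl; sym; trans; cong; subst; isEquivalence)
open import Relation.Binary.Construct.Closure.ReflexiveTransitive
  using (Star; ε; _◅_; _◅◅_; reverse; gmap)

-- Decidable reachability and comprehension of subsets.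

-- Floyd–Warshall: Via vs x y allows only the vertices in vs as intermediate stops.
module Reachability {n : ℕ} {R : Fin n → Fin n → Set} (R? : Decidable R) where

  Via : List (Fin n) → Fin n → Fin n → Set
  Via []       x y = x ≡ y ⊎ R x y
  Via (v ∷ vs) x y = Via vs x y ⊎ (Via vs x v × Via vs v y)

  via? : ∀ vs → Decidable (Via vs)
  via? []       x y = (x ≟ y) ⊎-dec R? x y
  via? (v ∷ vs) x y = via? vs x y ⊎-dec (via? vs x v ×-dec via? vs v y)

  via⇒star : ∀ vs {x y} → Via vs x y → Star R x y
  via⇒star []       (inj₁ refl)    = ε
  via⇒star []       (inj₂ r)       = r ◅ ε
  via⇒star (v ∷ vs) (inj₁ p)       = via⇒star vs p
  via⇒star (v ∷ vs) (inj₂ (p , q)) = via⇒star vs p ◅◅ via⇒star vs q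

  base⇒via : ∀ vs {x y} → x ≡ y ⊎ R x y → Via vs x y
  base⇒via []       p = p
  base⇒via (v ∷ vs) p = inj₁ (base⇒via vs p)

  via-trans : ∀ {vs x v y} → v ∈ˡ vs → Via vs x v → Via vs v y → Via vs x y
  via-trans {v ∷ vs} (here refl) p q = inj₂ ([ (λ z → z) , proj₁ ]′ p , [ (λ z → z) , proj₂ ]′ q)
  via-trans {u ∷ vs} (there i) (inj₁ p)       (inj₁ q)       = inj₁ (via-trans i p q)
  via-trans {u ∷ vs} (there i) (inj₁ p)       (inj₂ (q , r)) = inj₂ (via-trans i p q , r)
  via-trans {u ∷ vs} (there i) (inj₂ (p , q)) (inj₁ r)       = inj₂ (p , via-trans i q r)
  -- Both halves visit `u`, so the part from `u` through `v` back to `u` is dropped.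
  via-trans {u ∷ vs} (there i) (inj₂ (p , q)) (inj₂ (r , s)) = inj₂ (p , s)

  star⇒via : ∀ {x y} → Star R x y → Via (allFin n) x y
  star⇒via ε       = base⇒via (allFin n) (inj₁ refl)
  star⇒via (r ◅ p) = via-trans (∈-allFin _) (base⇒via (allFin n) (inj₂ r)) (star⇒via p)

  star? : Decidable (Star R)
  star? x y = map′ (via⇒star (allFin n)) star⇒via (via? (allFin n) x y)

module _ {n : ℕ} {P : Fin n → Set} (P? : Decidable₁ P) where

  select : Subset n
  select = Vec.tabulate (λ x → does (P? x))

  select⁺ : ∀ {x} → P x → x ∈ select
  select⁺ {x} p = lookup⇒[]= x _ (trans (lookup∘tabulate _ x) (dec-true (P? x) p))

  select⁻ : ∀ {x} → x ∈ select → P x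
  select⁻ {x} x∈ with P? x | trans (sym (lookup∘tabulate (λ y → does (P? y)) x)) ([]=⇒lookup x∈)
  ... | yes p | _ = p

∈-insert⁻ : ∀ {n} {X : Subset n} {w x} → x ∈ X ∪ ⁅ w ⁆ → x ∈ X ⊎ x ≡ w
∈-insert⁻ {X = X} {w} x∈ = Sum.map₂ (x∈⁅y⁆⇒x≡y w) (x∈p∪q⁻ X ⁅ w ⁆ x∈)

∈-insert : ∀ {n} {X : Subset n} {w} → w ∈ X ∪ ⁅ w ⁆
∈-insert {w = w} = q⊆p∪q _ _ (x∈⁅x⁆ w)

-- Trails with marks, and their reduction to m-connecting paths.

-- Status P C l v r: a trail may pass v with marks l and r (true = arrowhead), colliders being
-- required to satisfy P and noncolliders to avoid C.
data Status {n : ℕ} (P : Fin n → Set) (C : Subset n) : Bool → Fin n → Bool → Set where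
  collider : ∀ {v}   → P v   → Status P C true v true
  tailˡ    : ∀ {v r} → v ∉ C → Status P C false v r
  tailʳ    : ∀ {l v} → v ∉ C → Status P C l v false

module _ {n : ℕ} {P : Fin n → Set} {C : Subset n} where

  Status-swap : ∀ {l v r} → Status P C l v r → Status P C r v l
  Status-swap (collider p) = collider p
  Status-swap (tailˡ v∉)   = tailʳ v∉
  Status-swap (tailʳ v∉)   = tailˡ v∉

  free-status : ∀ {v} → v ∉ C → P v → ∀ l r → Status P C l v r
  free-status v∉ p true  true  = collider p
  free-status v∉ p true  false = tailʳ v∉
  free-status v∉ p false r     = tailˡ v∉

  noncollider-∉ : ∀ {v r} → Status P C false v r → v ∉ C
  noncollider-∉ (tailˡ v∉) = v∉
  noncollider-∉ (tailʳ v∉) = v∉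

  ∈-collider : ∀ {l v r} → v ∈ C → Status P C l v r → l ≡ true × r ≡ true
  ∈-collider v∈ (collider _) = refl , refl
  ∈-collider v∈ (tailˡ v∉)   = contradiction v∈ v∉
  ∈-collider v∈ (tailʳ v∉)   = contradiction v∈ v∉

Status-map : ∀ {n} {P Q : Fin n → Set} {C l v r} → (P v → Q v) → Status P C l v r → Status Q C l v r
Status-map f (collider p) = collider (f p)
Status-map f (tailˡ v∉)   = tailˡ v∉
Status-map f (tailʳ v∉)   = tailʳ v∉

module _ {n : ℕ} (G : ADMG n) where
  open ADMG G

  data Link : Bool → Bool → Fin n → Fin n → Set where
    fwd : ∀ {u v} → dir u v ≡ true → Link false true u v
    bwd : ∀ {u v} → dir v u ≡ true → Link true false u v
    bid : ∀ {u v} → bi u v ≡ true → Link true true u v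

  link-flip : ∀ {l r u v} → Link l r u v → Link r l v u
  link-flip (fwd e) = bwd e
  link-flip (bwd e) = fwd e
  link-flip (bid e) = bid (bi-sym _ _ e)

  -- Trail P C h v b: a walk from v to b to be entered at v with mark h.  With h = false and
  -- v ∉ C the first vertex is unconstrained, so these are the walks that start at v.
  data Trail (P : Fin n → Set) (C : Subset n) : Bool → Fin n → Fin n → Set where
    stop : ∀ {h v} → Trail P C h v v
    go   : ∀ {h l r v x b} → Status P C h v l → Link l r v x → Trail P C r x b → Trail P C h v b

  anc? : Decidable (Anc G)
  anc? = Reachability.star? (λ x y → dir x y ≟ᵇ true)

  inAn? : ∀ C → Decidable₁ (InAn G C)
  inAn? C v = any? (λ c → (c ∈? C) ×-dec anc? v c)

  inAn-mono : ∀ {X Y} → X ⊆ Y → ∀ {v} → InAn G X v → InAn G Y v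
  inAn-mono X⊆Y (c , c∈ , p) = c , X⊆Y c∈ , p

  inAn-self : ∀ {X v} → v ∈ X → InAn G X v
  inAn-self v∈ = _ , v∈ , ε

  inAn-step : ∀ {X u v} → Anc G u v → InAn G X v → InAn G X u
  inAn-step p (c , c∈ , q) = c , c∈ , p ◅◅ q

  module _ {P : Fin n → Set} {C : Subset n} where

    len : ∀ {h v b} → Trail P C h v b → ℕ
    len stop       = 0
    len (go _ _ t) = suc (len t)

    verts : ∀ {h v b} → Trail P C h v b → List (Fin n)
    verts {v = v} stop       = v ∷ []
    verts {v = v} (go _ _ t) = v ∷ verts t

    ∈-verts-head : ∀ {h v b} (t : Trail P C h v b) → v ∈ˡ verts t
    ∈-verts-head stop       = here refl
    ∈-verts-head (go _ _ _) = here refl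

    _⋯_ : ∀ {h v b c} → Trail P C h v b → (∀ h′ → Trail P C h′ b c) → Trail P C h v c
    stop     ⋯ t = t _
    go o e s ⋯ t = go o e (s ⋯ t)

    -- Since `v` is not an ancestor of `C`, the directed path from `v` to `a` avoids `C`; traversed
    -- backwards, it passes open noncolliders only.
    climb : ∀ {v a b} → Anc G v a → ¬ InAn G C v → Trail P C false v b → Trail P C false a b
    climb ε       ∉an t = t
    climb (e ◅ p) ∉an t =
      climb p (∉an ∘ inAn-step (e ◅ ε)) (go (tailˡ (∉an ∘ inAn-step (e ◅ ε) ∘ inAn-self)) (bwd e) t)

    descend : ∀ {h v b} → Anc G v b → ¬ InAn G C v → Trail P C h v b
    descend ε       ∉an = stop
    descend (e ◅ p) ∉an = go (tailʳ (∉an ∘ inAn-self)) (fwd e) (descend p (∉an ∘ inAn-step (e ◅ ε)))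

  -- From the last collider that is an ancestor of the source but not of C, climb directly to the source.
  drop-source : ∀ {a C} {Q : Fin n → Set} → (∀ {v} → InAn G C v → Q v) → ∀ {h v b} →
    Trail (λ u → Anc G u a ⊎ Q u) C h v b → Trail Q C h v b ⊎ Trail Q C false a b
  drop-source q stop = inj₁ stop
  drop-source q (go o e t) with drop-source q t
  ... | inj₂ s = inj₂ s
  drop-source q (go (tailˡ v∉) e t) | inj₁ s = inj₁ (go (tailˡ v∉) e s)
  drop-source q (go (tailʳ v∉) e t) | inj₁ s = inj₁ (go (tailʳ v∉) e s)
  drop-source q (go (collider (inj₂ c)) e t) | inj₁ s = inj₁ (go (collider c) e s)
  drop-source {C = C} q (go {v = v} (collider (inj₁ p)) e t) | inj₁ s with inAn? C v
  ... | yes c  = inj₁ (go (collider (q c)) e s)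
  ... | no ∉an = inj₂ (climb p ∉an (go (tailˡ (∉an ∘ inAn-self)) e s))

  -- At the first collider that is no ancestor of `C`, the rest of the trail is replaced by a
  -- directed path to `b`.
  drop-target : ∀ {C h v b} → Trail (λ u → Anc G u b ⊎ InAn G C u) C h v b → Trail (InAn G C) C h v b
  drop-target stop = stop
  drop-target (go (tailˡ v∉) e t) = go (tailˡ v∉) e (drop-target t)
  drop-target (go (tailʳ v∉) e t) = go (tailʳ v∉) e (drop-target t)
  drop-target (go (collider (inj₂ c)) e t) = go (collider c) e (drop-target t)
  drop-target {C} (go {v = v} (collider (inj₁ p)) e t) with inAn? C v
  ... | yes c  = go (collider c) e (drop-target t)
  ... | no ∉an = descend p ∉an

  record Suffix {C h v b} (t : Trail (InAn G C) C h v b) (x : Fin n) : Set where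
    constructor suffix
    field
      {mark} : Bool
      rest   : Trail (InAn G C) C mark x b
      unique : Unique (verts t) → Unique (verts rest)
      -- Entered through an arrowhead, a trail stays directed until its first collider.
      origin : h ≡ true → InAn G C v ⊎ (Anc G v x × mark ≡ true)

  suffix-at : ∀ {C h v b x} (t : Trail (InAn G C) C h v b) → x ∈ˡ verts t → Suffix t x
  suffix-at stop       (here refl) = suffix stop (λ u → u) (λ eq → inj₂ (ε , eq))
  suffix-at (go o e t) (here refl) = suffix (go o e t) (λ u → u) (λ eq → inj₂ (ε , eq))
  suffix-at {C = C} {x = x} (go {v = v} o e t) (there i) with suffix-at t i
  ... | suffix {m} s uniq orig = suffix s (λ { (_ ∷ u) → uniq u }) (λ { refl → here-or-later o e orig })
    where
    here-or-later : ∀ {l r y} → Status (InAn G C) C true v l → Link l r v y →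
      (r ≡ true → InAn G C y ⊎ (Anc G y x × m ≡ true)) → InAn G C v ⊎ (Anc G v x × m ≡ true)
    here-or-later (collider c) _       _ = inj₁ c
    here-or-later (tailʳ _)    (fwd d) k =
      Sum.map (inAn-step (d ◅ ε)) (λ (p , eq) → d ◅ p , eq) (k refl)

  -- A repeated vertex keeps its first entering mark and takes the leaving mark of its later visit.
  -- The delicate case is a first visit left by a tail and a later one entered by a tail: the
  -- directed stretch leaving `v` must meet a collider before it returns, so `v` is in an(C) and may
  -- become a collider.
  loop-erase : Acyclic G → ∀ {C h v b} → Trail (InAn G C) C h v b →
    Σ (Trail (InAn G C) C h v b) (λ t → Unique (verts t))
  loop-erase acyc stop = stop , [] ∷ []
  loop-erase acyc {C} {h} {v} {b} (go o e t) with loop-erase acyc t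
  ... | s , u with mem? _≟_ v (verts s)
  ... | no v∉s  = go o e s , ¬Any⇒All¬ _ v∉s ∷ u
  ... | yes v∈s with suffix-at s v∈s
  ... | suffix stop uniq orig = stop , uniq u
  ... | suffix {m} (go o′ e′ s′) uniq orig = go (bridge o e o′ orig) e′ s′ , uniq u
    where
    bridge : ∀ {l r x l′} → Status (InAn G C) C h v l → Link l r v x → Status (InAn G C) C m v l′ →
      (r ≡ true → InAn G C x ⊎ (Anc G x v × m ≡ true)) → Status (InAn G C) C h v l′
    bridge (collider p) _ (collider _) _ = collider p
    bridge (tailˡ v∉)   _ _            _ = tailˡ v∉
    bridge _            _ (tailʳ v∉)   _ = tailʳ v∉
    bridge {l′ = l′} (collider p) _ (tailˡ v∉) _ = free-status v∉ p _ l′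
    bridge (tailʳ v∉) _ (collider p) _ = free-status v∉ p _ _
    bridge {l′ = false} (tailʳ v∉) (fwd d) (tailˡ _) k = tailʳ v∉
    bridge {l′ = true} (tailʳ v∉) (fwd d) (tailˡ _) k with k refl
    ... | inj₁ p        = free-status v∉ (inAn-step (d ◅ ε) p) _ _
    ... | inj₂ (_ , ())

  link⇒edge : ∀ {l r u v} → Link l r u v → Edge G u v
  link⇒edge (fwd d) = fwd d
  link⇒edge (bwd d) = bwd d
  link⇒edge (bid d) = bid d

  toWalk : ∀ {P C h v b} → Trail P C h v b → Walk G v b
  toWalk stop       = single _
  toWalk (go _ e t) = step (link⇒edge e) (toWalk t)

  vertices-toWalk : ∀ {P C h v b} (t : Trail P C h v b) → vertices G (toWalk t) ≡ verts t
  vertices-toWalk stop       = refl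
  vertices-toWalk (go _ e t) = cong (_ ∷_) (vertices-toWalk t)

  status⇒ok : ∀ {C l v r} → Status (InAn G C) C l v r → OkGiven G C (l , v , r)
  status⇒ok (collider p)         = p
  status⇒ok (tailˡ v∉)           = v∉
  status⇒ok {l = true} (tailʳ v∉)  = v∉
  status⇒ok {l = false} (tailʳ v∉) = v∉

  ok⇒status : ∀ {C v} l r → OkGiven G C (l , v , r) → Status (InAn G C) C l v r
  ok⇒status true  true  p  = collider p
  ok⇒status true  false v∉ = tailʳ v∉
  ok⇒status false r     v∉ = tailˡ v∉

  toWalk-ok : ∀ {C h v b} (t : Trail (InAn G C) C h v b) → All (OkGiven G C) (interiorFrom G h (toWalk t))
  toWalk-ok stop               = []
  toWalk-ok (go o e@(fwd _) t) = status⇒ok o ∷ toWalk-ok t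
  toWalk-ok (go o e@(bwd _) t) = status⇒ok o ∷ toWalk-ok t
  toWalk-ok (go o e@(bid _) t) = status⇒ok o ∷ toWalk-ok t

  toWalk-interior : ∀ {C v b} (t : Trail (InAn G C) C false v b) → All (OkGiven G C) (interior G (toWalk t))
  toWalk-interior stop       = []
  toWalk-interior (go o e t) with toWalk-ok (go o e t)
  ... | _ ∷ oks = oks

  fromWalk : ∀ {C h v b} (w : Walk G v b) → All (OkGiven G C) (interiorFrom G h w) →
    Trail (InAn G C) C h v b
  fromWalk (single _) [] = stop
  fromWalk {h = h} (step (fwd d) w) (o ∷ os) = go (ok⇒status h _ o) (fwd d) (fromWalk w os)
  fromWalk {h = h} (step (bwd d) w) (o ∷ os) = go (ok⇒status h _ o) (bwd d) (fromWalk w os)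
  fromWalk {h = h} (step (bid d) w) (o ∷ os) = go (ok⇒status h _ o) (bid d) (fromWalk w os)

  fromPath : ∀ {C v b} → v ∉ C → (w : Walk G v b) → All (OkGiven G C) (interior G w) →
    Trail (InAn G C) C false v b
  fromPath v∉ (single _) _  = stop
  fromPath v∉ (step e w) os = fromWalk (step e w) (v∉ ∷ os)

  NoPath : Fin n → Fin n → Subset n → Set
  NoPath a b C = (w : Walk G a b) → ¬ MConnecting G C w

  Near : Fin n → Fin n → Subset n → Fin n → Set
  Near a b C v = Anc G v a ⊎ Anc G v b ⊎ InAn G C v

  -- Colliders that are ancestors of an endpoint only are bypassed by directed paths, first those
  -- above `a`, then those above `b`; loop erasure then gives a path.
  separated⇒no-trail : Acyclic G → ∀ {a b C} → NoPath a b C → ¬ Trail (Near a b C) C false a b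
  separated⇒no-trail acyc sep t with loop-erase acyc (drop-target ([ (λ s → s) , (λ s → s) ]′ (drop-source inj₂ t)))
  ... | s , u = sep (toWalk s) (subst Unique (sym (vertices-toWalk s)) u , toWalk-interior s)

  -- Districts, hubs and the parametrizing set.

  inDis? : ∀ {D : Fin n → Set} → Decidable₁ D → Decidable (InDis G D)
  inDis? D? q x =
    D? q ×-dec Reachability.star? (λ u v → D? u ×-dec (D? v ×-dec (bi u v ≟ᵇ true))) q x

  biIn-mono : ∀ {D E : Fin n → Set} → (∀ {v} → D v → E v) → ∀ {u v} → BiIn G D u v → BiIn G E u v
  biIn-mono f (d , e , b) = f d , f e , b

  inDis-mono : ∀ {D E : Fin n → Set} → (∀ {v} → D v → E v) → ∀ {u v} → InDis G D u v → InDis G E u v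
  inDis-mono f (d , p) = f d , gmap (λ v → v) (biIn-mono f) p

  inDis-target : ∀ {D : Fin n → Set} {u v} → InDis G D u v → D v
  inDis-target {D} (d , p) = last d p
    where
    last : ∀ {u v} → D u → Star (BiIn G D) u v → D v
    last d ε                 = d
    last _ ((_ , e , _) ◅ p) = last e p

  inDis-sym : ∀ {D : Fin n → Set} {u v} → InDis G D u v → InDis G D v u
  inDis-sym dis@(_ , p) = inDis-target dis , reverse (λ (d , e , b) → e , d , bi-sym _ _ b) p

  inDis-trans : ∀ {D : Fin n → Set} {u v w} → InDis G D u v → InDis G D v w → InDis G D u w
  inDis-trans (d , p) (_ , q) = d , p ◅◅ q

  -- For `q` in a head H and `D` = an(H), this is H ∪ tail(H).
  Touches : (Fin n → Set) → Fin n → Fin n → Set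
  Touches D q x = InDis G D q x ⊎ ∃ λ d → InDis G D q d × dir x d ≡ true

  touches? : ∀ {D : Fin n → Set} → Decidable₁ D → Decidable (Touches D)
  touches? D? q x = inDis? D? q x ⊎-dec any? (λ d → inDis? D? q d ×-dec (dir x d ≟ᵇ true))

  touches-mono : ∀ {D E : Fin n → Set} → (∀ {v} → D v → E v) → ∀ {q x} → Touches D q x → Touches E q x
  touches-mono f = Sum.map (inDis-mono f) (λ (d , dis , e) → d , inDis-mono f dis , e)

  touches-rebase : ∀ {D : Fin n → Set} {q q′ x} → InDis G D q q′ → Touches D q x → Touches D q′ x
  touches-rebase dis = Sum.map (inDis-trans (inDis-sym dis))
                               (λ (d , dis′ , e) → d , inDis-trans (inDis-sym dis) dis′ , e)

  -- W belongs to the parametrizing set iff it has a hub: the head is then barren(W), and an(W) = an(head).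
  Hub : Subset n → Fin n → Set
  Hub X q = InAn G X q × ∀ x → x ∈ X → Touches (InAn G X) q x

  hub-rebase : ∀ {X q q′} → InDis G (InAn G X) q q′ → Hub X q → Hub X q′
  hub-rebase dis (_ , t) = inDis-target dis , λ x x∈ → touches-rebase dis (t x x∈)

  Into : Fin n → Fin n → Set
  Into w q = dir w q ≡ true ⊎ bi w q ≡ true

  hub-extend : ∀ {X q w} → Hub X q → Into w q → Hub (X ∪ ⁅ w ⁆) q
  hub-extend {X} {q} {w} (anq , t) w→q = grow anq , touch
    where
    grow : ∀ {v} → InAn G X v → InAn G (X ∪ ⁅ w ⁆) v
    grow = inAn-mono (p⊆p∪q _)

    touch : ∀ x → x ∈ X ∪ ⁅ w ⁆ → Touches (InAn G (X ∪ ⁅ w ⁆)) q x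
    touch x x∈ with ∈-insert⁻ x∈
    ... | inj₁ x∈X  = touches-mono grow (t x x∈X)
    ... | inj₂ refl =
      [ (λ e → inj₂ (q , (grow anq , ε) , e))
      , (λ b → inj₁ (grow anq , (grow anq , inAn-self ∈-insert , bi-sym _ _ b) ◅ ε)) ]′ w→q

  hub-extend-bi : ∀ {X q w} → Hub X q → bi w q ≡ true → Hub (X ∪ ⁅ w ⁆) w
  hub-extend-bi hub b with hub-extend hub (inj₂ b)
  ... | ext@(anq , _) =
    hub-rebase (anq , (anq , inAn-self ∈-insert , bi-sym _ _ b) ◅ ε) ext

  hub-singleton : ∀ q → Hub ⁅ q ⁆ q
  hub-singleton q = inAn-self (x∈⁅x⁆ q) , touch
    where
    touch : ∀ x → x ∈ ⁅ q ⁆ → Touches (InAn G ⁅ q ⁆) q x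
    touch x x∈ with x∈⁅y⁆⇒x≡y q x∈
    ... | refl = inj₁ (inAn-self (x∈⁅x⁆ q) , ε)

  InS⇒hub : ∀ {W} → InS G W → ∃ (Hub W)
  InS⇒hub (H , (_ , q , anq , dis) , A , tail , refl) = q , grow anq , touch
    where
    grow : ∀ {v} → InAn G H v → InAn G (H ∪ A) v
    grow = inAn-mono (p⊆p∪q A)

    touch : ∀ x → x ∈ H ∪ A → Touches (InAn G (H ∪ A)) q x
    touch x x∈ with x∈p∪q⁻ H A x∈
    ... | inj₁ x∈H = inj₁ (inDis-mono grow (dis x x∈H))
    ... | inj₂ x∈A with tail x x∈A
    ... | inj₁ ((h , h∈ , hx) , _)     = inj₁ (inDis-mono grow (inDis-trans (dis h h∈) hx))
    ... | inj₂ (d , (h , h∈ , hd) , e) =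
      inj₂ (d , inDis-mono grow (inDis-trans (dis h h∈) hd) , e)

  -- Trails that may be entered with any mark can be concatenated.
  Linked : (Fin n → Set) → Subset n → Fin n → Fin n → Set
  Linked P C x y = ∀ h → Trail P C h x y

  module _ {P : Fin n → Set} {C X : Subset n} (inside : ∀ {v} → InAn G X v → P v) where

    private
      cross : ∀ {h c q y} → Status P C h c true → Star (BiIn G (InAn G X)) c q →
        y ≡ q ⊎ dir y q ≡ true → Trail P C h c y
      cross o ε (inj₁ refl)              = stop
      cross o ε (inj₂ e)                 = go o (bwd e) stop
      cross o ((_ , d , b) ◅ p) end = go o (bid b) (cross (collider (inside d)) p end)

    -- A bidirected path inside the district of the hub joins `x` to `y`, with a parent edge added
    -- at either end if necessary; its inner vertices are colliders in an(X). The start `x`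
    -- tolerates all marks, lying outside `C` and satisfying `P`.
    hub-linked : ∀ {q x y} → Hub X q → x ∈ X → y ∈ X → x ∉ C → Linked P C x y
    hub-linked {q} {x} {y} (_ , touch) x∈ y∈ x∉C h with touch x x∈ | touch y y∈
    ... | inj₁ qx | inj₁ qy =
      cross (free-status x∉C (inside (inAn-self x∈)) _ _) (proj₂ (inDis-trans (inDis-sym qx) qy)) (inj₁ refl)
    ... | inj₁ qx | inj₂ (d , qd , e) =
      cross (free-status x∉C (inside (inAn-self x∈)) _ _) (proj₂ (inDis-trans (inDis-sym qx) qd)) (inj₂ e)
    ... | inj₂ (c , qc , e) | inj₁ qy =
      go (free-status x∉C (inside (inAn-self x∈)) _ _) (fwd e)
        (cross (collider (inside (inDis-target qc))) (proj₂ (inDis-trans (inDis-sym qc) qy)) (inj₁ refl))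
    ... | inj₂ (c , qc , e) | inj₂ (d , qd , e′) =
      go (free-status x∉C (inside (inAn-self x∈)) _ _) (fwd e)
        (cross (collider (inside (inDis-target qc))) (proj₂ (inDis-trans (inDis-sym qc) qd)) (inj₂ e′))

  -- Barren vertices; parametrizing sets versus separations.

  module _ (acyc : Acyclic G) where

    anc-antisym : ∀ {x y} → Anc G x y → Anc G y x → x ≡ y
    anc-antisym ε       _ = refl
    anc-antisym (e ◅ p) q = ⊥-elim (acyc _ _ e (p ◅◅ q))

    dir⇒≢ : ∀ {x y} → dir x y ≡ true → x ≢ y
    dir⇒≢ e refl = acyc _ _ e ε

    _⊏_ : Fin n → Fin n → Set
    x ⊏ y = Anc G x y × y ≢ x

    ⊏-isStrictPartialOrder : IsStrictPartialOrder _≡_ _⊏_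
    ⊏-isStrictPartialOrder = record
      { isEquivalence = isEquivalence
      ; irrefl        = λ eq (_ , neq) → neq (sym eq)
      ; trans         = λ { (p , i≢j) (q , _) → p ◅◅ q , λ { refl → i≢j (anc-antisym q p) } }
      ; <-resp-≈      = (λ { refl r → r }) , (λ { refl r → r })
      }

    ⊏-noetherian : WellFounded (flip _⊏_)
    ⊏-noetherian = spo-noetherian ⊏-isStrictPartialOrder

    IsBarrenIn : Subset n → Fin n → Set
    IsBarrenIn W h = h ∈ W × ∀ w → w ∈ W → Anc G h w → w ≡ h

    isBarrenIn? : ∀ W → Decidable₁ (IsBarrenIn W)
    isBarrenIn? W h = (h ∈? W) ×-dec all? (λ w → (w ∈? W) →-dec (anc? h w →-dec (w ≟ h)))

    barren-descendant : ∀ {W w} → w ∈ W → ∃ λ h → IsBarrenIn W h × Anc G w h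
    barren-descendant {W} {w} = go′ w (⊏-noetherian w)
      where
      go′ : ∀ w → Acc (flip _⊏_) w → w ∈ W → ∃ λ h → IsBarrenIn W h × Anc G w h
      go′ w (acc rec) w∈ with any? (λ x → (x ∈? W) ×-dec (anc? w x ×-dec ¬? (x ≟ w)))
      ... | yes (x , x∈ , w⊏x) with go′ x (rec w⊏x) x∈
      ... | h , bar , p = h , bar , proj₁ w⊏x ◅◅ p
      go′ w (acc rec) w∈ | no none =
        w , (w∈ , λ x x∈ p → decidable-stable (x ≟ w) (λ neq → none (x , x∈ , p , neq))) , ε

    hub⇒InS : ∀ {W} → ∃ (Hub W) → InS G W
    hub⇒InS {W} (q , anq , touch) =
      H , (barren , q , to-head anq , in-district) , A , tail , ⊆-antisym split join
      where
      H = select (isBarrenIn? W)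
      A = select (λ x → (x ∈? W) ×-dec ¬? (x ∈? H))

      H⊆W : H ⊆ W
      H⊆W = proj₁ ∘ select⁻ (isBarrenIn? W)

      barren : Barren G H
      barren h w h∈ w∈ = proj₂ (select⁻ (isBarrenIn? W) h∈) w (H⊆W w∈)

      to-head : ∀ {v} → InAn G W v → InAn G H v
      to-head (w , w∈ , p) with barren-descendant w∈
      ... | h , bar , p′ = h , select⁺ (isBarrenIn? W) bar , p ◅◅ p′

      in-district : ∀ h → h ∈ H → InDis G (InAn G H) q h
      in-district h h∈ with select⁻ (isBarrenIn? W) h∈
      ... | h∈W , bar with touch h h∈W
      ... | inj₁ dis = inDis-mono to-head dis
      -- A barren `h` is no parent of the district: the child would have a descendant in `W`,
      -- necessarily `h` itself, closing a cycle.
      ... | inj₂ (d , dis , e) with inDis-target dis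
      ... | w , w∈ , p with bar w w∈ (e ◅ p)
      ... | refl = ⊥-elim (acyc _ _ e p)

      tail : ∀ x → x ∈ A → InTail G H x
      tail x x∈ with select⁻ (λ y → (y ∈? W) ×-dec ¬? (y ∈? H)) x∈ | to-head anq
      ... | x∈W , x∉H | h , h∈ , _ with touches-mono to-head (touch x x∈W) | inDis-sym (in-district h h∈)
      ... | inj₁ dis           | hq = inj₁ ((h , h∈ , inDis-trans hq dis) , x∉H)
      ... | inj₂ (d , dis , e) | hq = inj₂ (d , (h , h∈ , inDis-trans hq dis) , e)

      split : W ⊆ H ∪ A
      split {x} x∈ with x ∈? H
      ... | yes x∈H = x∈p∪q⁺ (inj₁ x∈H)
      ... | no x∉H  = x∈p∪q⁺ (inj₂ (select⁺ (λ y → (y ∈? W) ×-dec ¬? (y ∈? H)) (x∈ , x∉H)))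

      join : H ∪ A ⊆ W
      join x∈ with x∈p∪q⁻ H A x∈
      ... | inj₁ x∈H = H⊆W x∈H
      ... | inj₂ x∈A = proj₁ (select⁻ (λ y → (y ∈? W) ×-dec ¬? (y ∈? H)) x∈A)

    -- Being barren in X, the vertex k lies in the district of the hub, so w is adjoined through k.
    inS-extend : ∀ {X k w} → InS G X → k ∈ X → (∀ x → x ∈ X → Anc G k x → x ≡ k) →
      Into w k → InS G (X ∪ ⁅ w ⁆)
    inS-extend {X} {k} inS k∈ bar w→k with InS⇒hub inS
    ... | q , hub@(_ , touch) with touch k k∈
    ... | inj₁ dis = hub⇒InS (k , hub-extend (hub-rebase dis hub) w→k)
    ... | inj₂ (d , dis , e) with inDis-target dis
    ... | x , x∈ , p with bar x x∈ (e ◅ p)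
    ... | refl = ⊥-elim (acyc _ _ e p)

    -- The collider path through a hub of `W` stays in an(W), which `cover` places inside an(a, b,
    -- C).
    inS⇒connected : ∀ {W a b C} → InS G W → a ∈ W → b ∈ W → a ∉ C →
      (∀ x → x ∈ W → x ≡ a ⊎ x ≡ b ⊎ x ∈ C) → ¬ NoPath a b C
    inS⇒connected {W} {a} {b} {C} inS a∈ b∈ a∉C cover sep with InS⇒hub inS
    ... | q , hub = separated⇒no-trail acyc sep (hub-linked inside hub a∈ b∈ a∉C false)
      where
      inside : ∀ {v} → InAn G W v → Near a b C v
      inside (w , w∈ , p) with cover w w∈
      ... | inj₁ refl        = inj₁ p
      ... | inj₂ (inj₁ refl) = inj₂ (inj₁ p)
      ... | inj₂ (inj₂ w∈C)  = inj₂ (inj₂ (w , w∈C , p))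

    module _ {W : Subset n} {h x : Fin n} (bar : IsBarrenIn W h) (x∈W : x ∈ W)
             (apart : ¬ Touches (InAn G W) h x) where

      private
        rest? : Decidable₁ (λ v → InAn G W v × v ≢ h × v ≢ x)
        rest? v = inAn? W v ×-dec (¬? (v ≟ h) ×-dec ¬? (v ≟ x))

      rest-of-an : Subset n
      rest-of-an = select rest?

      ∈-rest : ∀ {v} → InAn G W v → v ≢ h → v ≢ x → v ∈ rest-of-an
      ∈-rest anv v≢h v≢x = select⁺ rest? (anv , v≢h , v≢x)

      h∉rest : h ∉ rest-of-an
      h∉rest h∈ = proj₁ (proj₂ (select⁻ rest? h∈)) refl

      x∉rest : x ∉ rest-of-an
      x∉rest x∈ = proj₂ (proj₂ (select⁻ rest? x∈)) refl

      untouched⇒≢ : x ≢ h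
      untouched⇒≢ refl = apart (inj₁ (inAn-self x∈W , ε))

      private
        -- Entered through an arrowhead, the trail runs forwards until a collider, which is in
        -- an(W), or until `x`.
        entered-inAn : ∀ {y} → Trail (InAn G rest-of-an) rest-of-an true y x → InAn G W y
        entered-inAn stop = inAn-self x∈W
        entered-inAn (go (collider (c , c∈ , p)) _ _) = inAn-step p (proj₁ (select⁻ rest? c∈))
        entered-inAn (go (tailʳ _) (fwd e) t) = inAn-step (e ◅ ε) (entered-inAn t)

        no-child : ∀ {y} → dir h y ≡ true → ¬ InAn G W y
        no-child e (w , w∈ , p) with proj₂ bar w w∈ (e ◅ p)
        ... | refl = acyc _ _ e p

        h∈an : InAn G W h
        h∈an = inAn-self (proj₁ bar)

        -- The invariant is that the trail stays in the district of `h` in an(W). A bidirected edge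
        -- preserves it. A step back to a parent reaches a vertex other than `h` and `x`, hence a
        -- noncollider inside the separating set. A step forward makes `v` such a noncollider,
        -- unless `v` is `h`, which has no child in an(W).
        no-trail : ∀ {m v} → InDis G (InAn G W) h v →
          ¬ Trail (InAn G rest-of-an) rest-of-an m v x
        no-trail dis stop = apart (inj₁ dis)
        no-trail {v = v} dis (go o e t) with v ≟ x
        ... | yes refl = apart (inj₁ dis)
        no-trail {v = v} dis (go o (bid b) t) | no v≢x =
          no-trail
            (inDis-trans dis (inDis-target dis , (inDis-target dis , entered-inAn t , b) ◅ ε)) t
        no-trail {v = v} dis (go o (bwd e) stop) | no v≢x = apart (inj₂ (v , dis , e))
        no-trail {v = v} dis (go o (bwd {v = y} e) t@(go o′ _ _)) | no v≢x with y ≟ x | y ≟ h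
        ... | yes refl | _        = apart (inj₂ (v , dis , e))
        ... | no _     | yes refl = no-child e (inDis-target dis)
        ... | no y≢x   | no y≢h   =
          noncollider-∉ o′ (∈-rest (inAn-step (e ◅ ε) (inDis-target dis)) y≢h y≢x)
        no-trail {v = v} dis (go o (fwd e) t) | no v≢x with v ≟ h
        ... | yes refl = no-child e (entered-inAn t)
        no-trail dis (go (tailʳ v∉) (fwd e) t) | no v≢x | no v≢h =
          v∉ (∈-rest (inDis-target dis) v≢h v≢x)
        no-trail dis (go (tailˡ v∉) (fwd e) t) | no v≢x | no v≢h =
          v∉ (∈-rest (inDis-target dis) v≢h v≢x)

      untouched⇒separated : NoPath h x rest-of-an
      untouched⇒separated w (_ , oks) = no-trail {m = false} (h∈an , ε) (fromPath h∉rest w oks)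

  -- Strict trails and their shortening.

  -- With colliders in `C` itself, an inner vertex is a collider exactly when it is in `C`, with no
  -- reference to ancestors, which may differ between the two graphs.
  Strict : Subset n → Bool → Fin n → Fin n → Set
  Strict C = Trail (_∈ C) C

  private
    -- A collider in an(C) is replaced by a walk down to the first vertex in `C` and back, so
    -- vertices may repeat. `out` resumes the trail after returning to `v` from below; `up` passes
    -- `v` as a collider in `C`.
    excursion : ∀ {C v c b} → Anc G v c → c ∈ C →
      (v ∉ C → Strict C false v b) → (v ∈ C → Strict C true v b) → Strict C true v b
    excursion {C} {v} p c∈ out up with v ∈? C
    excursion p c∈ out up | yes v∈ = up v∈
    excursion ε c∈ out up | no v∉ = contradiction c∈ v∉
    excursion (e ◅ p) c∈ out up | no v∉ =
      go (tailʳ v∉) (fwd e)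
        (excursion p c∈ (λ z∉ → go (tailˡ z∉) (bwd e) (out v∉)) (λ z∈ → go (collider z∈) (bwd e) (out v∉)))

  strict : ∀ {C h v b} → Trail (InAn G C) C h v b → Strict C h v b
  strict stop = stop
  strict (go (tailˡ v∉) e t) = go (tailˡ v∉) e (strict t)
  strict (go (tailʳ v∉) e t) = go (tailʳ v∉) e (strict t)
  strict (go (collider (c , c∈ , p)) e t) =
    excursion p c∈ (λ v∉ → go (tailˡ v∉) e (strict t)) (λ v∈ → go (collider v∈) e (strict t))

  module _ {C : Subset n} where

    forget-mark : ∀ {v b} → v ∉ C → Strict C true v b → Strict C false v b
    forget-mark v∉ stop       = stop
    forget-mark v∉ (go _ e t) = go (tailˡ v∉) e t

    -- The left part is stored reversed, as in a zipper, so that both parts start at the place where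
    -- the trail is cut.
    join : ∀ {P a l r u w b} → a ∉ C → Trail P C l u a → Link l r u w → Trail P C r w b → Trail P C false a b
    join a∉ stop       e r = go (tailˡ a∉) e r
    join a∉ (go o e′ l) e r = join a∉ l (link-flip e′) (go (Status-swap o) e r)

    len-join : ∀ {P a l r u w b} (a∉ : a ∉ C) (s : Trail P C l u a) (e : Link l r u w) (t : Trail P C r w b) →
      len (join a∉ s e t) ≡ suc (len s + len t)
    len-join a∉ stop        e t = refl
    len-join a∉ (go o e′ s) e t =
      trans (len-join a∉ s (link-flip e′) (go (Status-swap o) e t)) (cong suc (+-suc (len s) (len t)))

    NoShorter : Fin n → Fin n → ℕ → Set
    NoShorter a b L = (t : Strict C false a b) → ¬ (len t < L)

    no-shorter-join : ∀ {a b L l r u w} → a ∉ C → NoShorter a b L →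
      (s : Strict C l u a) → Link l r u w → (t : Strict C r w b) → ¬ (suc (len s + len t) < L)
    no-shorter-join {L = L} a∉ min s e t lt = min (join a∉ s e t) (subst (_< L) (sym (len-join a∉ s e t)) lt)

    no-shorter-sym : ∀ {a b L} → a ∉ C → a ≢ b → NoShorter a b L → NoShorter b a L
    no-shorter-sym a∉ a≢b min stop       lt = a≢b refl
    no-shorter-sym {L = L} a∉ a≢b min (go o e t) lt =
      no-shorter-join a∉ min t (link-flip e) stop (subst (λ m → suc m < L) (+-comm 0 (len t)) lt)

  -- Discriminating paths at the noncolliders of a shortest trail.

  -- X ∪ {w} fails to be parametrizing only because of the position of k: a trace, expressed
  -- through the parametrizing set alone, of k being a noncollider next to w.
  record Witness (M : Fin n → Set) (k : Fin n) : Set where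
    constructor witness
    field
      X        : Subset n
      w        : Fin n
      k∈X      : k ∈ X
      X⊆M      : ∀ {x} → x ∈ X → M x
      w∈M      : M w
      k≢w      : k ≢ w
      edge-inS : InS G (⁅ k ⁆ ∪ ⁅ w ⁆)
      inS      : InS G X
      notInS   : ¬ InS G (X ∪ ⁅ w ⁆)

  -- The part of a collider walk from q on, to be extended by a link carrying mark m at q.
  data Growing : Bool → Subset n → Fin n → Set where
    seed : ∀ {m q}   → Growing m ⁅ q ⁆ q
    hub  : ∀ {X q} → Hub X q → Growing true X q

  module _ (acyc : Acyclic G) where

    growing-hub : ∀ {X q} → Growing true X q → Hub X q
    growing-hub seed    = hub-singleton _
    growing-hub (hub h) = h

    grow : ∀ {m X q t} → Growing m X q → Link m true q t → Hub (X ∪ ⁅ t ⁆) t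
    grow {q = q} {t} seed (fwd e) =
      subst (λ Y → Hub Y t) (∪-comm ⁅ t ⁆ ⁅ q ⁆) (hub-extend (hub-singleton t) (inj₁ e))
    grow g (bid b) = hub-extend-bi (growing-hub g) (bi-sym _ _ b)

    grow-inS : ∀ {m r X q t} → Growing m X q → Link m r q t → InS G (X ∪ ⁅ t ⁆)
    grow-inS g e@(fwd _) = hub⇒InS acyc (_ , grow g e)
    grow-inS g e@(bid _) = hub⇒InS acyc (_ , grow g e)
    grow-inS g (bwd e)   = hub⇒InS acyc (_ , hub-extend (growing-hub g) (inj₁ e))

  trail-map : ∀ {P Q C h v b} → (∀ {u} → P u → Q u) → Trail P C h v b → Trail Q C h v b
  trail-map f stop       = stop
  trail-map f (go o e t) = go (Status-map f o) e (trail-map f t)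

  len-forget-mark : ∀ {C v b} (v∉ : v ∉ C) (t : Strict C true v b) → len (forget-mark v∉ t) ≡ len t
  len-forget-mark v∉ stop       = refl
  len-forget-mark v∉ (go _ _ _) = refl

  -- In a shortest strict trail, a noncollider k → w that is not detected by its other neighbour
  -- ends a path t *→ q ↔ ⋯ ↔ u ←* k whose vertices between t and w are all parents of w, with t
  -- and w nonadjacent (a discriminating path); otherwise the trail could be shortened.
  module _ (mag : IsMAG G) (M : Fin n → Set) {C : Subset n} {L : ℕ} where

    private
      acyc : Acyclic G
      acyc = proj₁ mag

      maximal : Maximal G
      maximal = proj₁ (proj₂ mag)

      ancestral : Ancestral G
      ancestral = proj₂ (proj₂ mag)

      no-back : ∀ {p q t w} → dir q w ≡ true → Link true p q t → ¬ (dir w t ≡ true)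
      no-back qw (bwd tq) wt = acyc _ _ tq (qw ◅ wt ◅ ε)
      no-back qw (bid qt) wt = ancestral _ _ (bi-sym _ _ qt) (qw ◅ wt ◅ ε)

    module Noncollider {a b k w : Fin n} (a∉ : a ∉ C) (min : NoShorter {C} a b L)
        (kw : dir k w ≡ true) (k∈M : M k) (w∈M : M w) (r : Strict C true w b) where

      -- Every set separating a further vertex from w must contain X.
      Fence : Bool → Subset n → Fin n → Set
      Fence m X q = ∀ {D} → w ∉ D → ¬ Strict D m q w → ∀ {x} → x ∈ X → x ∈ D

      fence-seed : ∀ {m} → Fence m ⁅ k ⁆ k
      fence-seed {D = D} w∉ none x∈ with x∈⁅y⁆⇒x≡y k x∈
      ... | refl = decidable-stable (k ∈? D) (λ k∉ → none (go (tailʳ k∉) (fwd kw) stop))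

      -- Because `t → w`, a separating `D` must contain `t`. Then `t` is an open collider, so a walk
      -- from `q` to `w` would extend to one from `t`.
      fence-grow : ∀ {m X q t} → Fence m X q → Link m true q t → dir t w ≡ true → Fence true (X ∪ ⁅ t ⁆) t
      fence-grow {t = t} fence e tw {D = D} w∉ none x∈ with t ∈? D
      ... | no t∉  = contradiction (go (tailʳ t∉) (fwd tw) stop) none
      ... | yes t∈ with ∈-insert⁻ x∈
      ... | inj₁ x∈X  = fence w∉ (λ s → none (go (collider t∈) (link-flip e) s)) x∈X
      ... | inj₂ refl = t∈

      -- Maximality provides `D` separating `t` from `w`. The fence forces `X` into `D`, so
      -- membership in S would connect `t` and `w` given `D`.
      fence-notInS : ∀ {m p X q t} → Fence m X q → Link m p q t → t ≢ w → ¬ Adjacent G t w →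
        ¬ InS G ((X ∪ ⁅ t ⁆) ∪ ⁅ w ⁆)
      fence-notInS {X = X} {t = t} fence e t≢w nonadj inS with maximal t w t≢w nonadj
      ... | D , t∉ , w∉ , sep = inS⇒connected acyc inS (p⊆p∪q _ ∈-insert) ∈-insert t∉ cover separated
        where
        separated : NoPath t w D
        separated = sep t w (x∈⁅x⁆ t) (x∈⁅x⁆ w)

        none : ¬ Strict D _ _ w
        none s = separated⇒no-trail acyc separated
          (trail-map (inj₂ ∘ inj₂ ∘ inAn-self) (go (tailˡ t∉) (link-flip e) s))

        cover : ∀ x → x ∈ (X ∪ ⁅ t ⁆) ∪ ⁅ w ⁆ → x ≡ t ⊎ x ≡ w ⊎ x ∈ D
        cover x x∈ with ∈-insert⁻ x∈
        ... | inj₂ x≡w = inj₂ (inj₁ x≡w)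
        ... | inj₁ x∈′ with ∈-insert⁻ x∈′
        ... | inj₂ x≡t = inj₁ x≡t
        ... | inj₁ x∈X = inj₂ (inj₂ (fence w∉ none x∈X))

      -- Here the left part has come back to `w`, and the loop through `k` can be cut out.
      no-fold : (l : Strict C true w a) → ¬ (suc (suc (len l + len r)) ≤ L)
      no-fold l short with w ∈? C
      no-fold stop short | yes w∈ = a∉ w∈
      no-fold (go o e l) short | yes w∈ with ∈-collider w∈ o
      ... | _ , refl = no-shorter-join a∉ min l (link-flip e) r (≤-trans (n≤1+n _) short)
      no-fold stop short | no w∉ =
        min (forget-mark w∉ r) (subst (_< L) (sym (len-forget-mark w∉ r)) (≤-trans (n≤1+n _) short))
      no-fold (go (collider w∈) e l) short | no w∉ = w∉ w∈
      no-fold (go (tailʳ _) e l) short | no w∉ =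
        no-shorter-join a∉ min l (link-flip e) (forget-mark w∉ r)
          (subst (λ m → suc (len l + m) < L) (sym (len-forget-mark w∉ r)) (≤-trans (n≤1+n _) short))

      no-shortcut-fwd : ∀ {t} → (l : Strict C false t a) → suc (suc (len l + len r)) ≤ L → ¬ (dir t w ≡ true)
      no-shortcut-fwd l short tw = no-shorter-join a∉ min l (fwd tw) r short

      no-shortcut-bid : ∀ {t} → (l : Strict C true t a) → suc (suc (len l + len r)) ≤ L → ¬ (bi t w ≡ true)
      no-shortcut-bid l short tw = no-shorter-join a∉ min l (bid tw) r short

      record State (m : Bool) (q : Fin n) : Set where
        constructor state
        field
          X       : Subset n
          growing : Growing m X q
          fence   : Fence m X q
          k∈X     : k ∈ X
          X⊆M     : ∀ {x} → x ∈ X → M x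
          qw      : dir q w ≡ true

      start : ∀ {m} → State m k
      start = state ⁅ k ⁆ seed fence-seed (x∈⁅x⁆ k) (λ x∈ → subst M (sym (x∈⁅y⁆⇒x≡y k x∈)) k∈M) kw

      extend-⊆M : ∀ {X t} → (∀ {x} → x ∈ X → M x) → M t → ∀ {x} → x ∈ X ∪ ⁅ t ⁆ → M x
      extend-⊆M X⊆M t∈M x∈ with ∈-insert⁻ x∈
      ... | inj₁ x∈X  = X⊆M x∈X
      ... | inj₂ refl = t∈M

      detected : ∀ {m p q t} → State m q → Link m p q t → M t → t ≢ w → ¬ Adjacent G t w → Witness M k
      detected {t = t} (state X g fence k∈X X⊆M _) e t∈M t≢w nonadj =
        witness (X ∪ ⁅ t ⁆) w (p⊆p∪q _ k∈X) (extend-⊆M X⊆M t∈M) w∈M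
          (dir⇒≢ acyc kw) (grow-inS acyc seed (fwd kw)) (grow-inS acyc g e) (fence-notInS fence e t≢w nonadj)

      -- `t` is the next vertex towards `a`. If it is not adjacent to `w`, the discriminating path
      -- is complete. If `t → w` and the link has an arrowhead at `t`, `advance` continues. All
      -- other cases shorten the trail or contradict `¬wt`, acyclicity or ancestrality.
      resolve : ∀ {m p q t} → State m q → Link m p q t → (l : Strict C p t a) → (∀ {x} → x ∈ˡ verts l → M x) →
        suc (suc (len l + len r)) ≤ L → ¬ (dir w t ≡ true) → Witness M k

      -- Outside `C`, `t` would allow the shortcut `t → w`; so `t` is a collider in `C` and is added
      -- to `X`.
      advance : ∀ {m q t} → State m q → Link m true q t → (l : Strict C true t a) →
        (∀ {x} → x ∈ˡ verts l → M x) → suc (suc (len l + len r)) ≤ L → dir t w ≡ true → Witness M k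

      resolve {p = p} {t = t} s e l l⊆M short ¬wt with t ≟ w
      resolve s (bwd wq) l l⊆M short ¬wt | yes refl = ⊥-elim (acyc _ _ wq (State.qw s ◅ ε))
      resolve s (bid qw) l l⊆M short ¬wt | yes refl = ⊥-elim (ancestral _ _ (bi-sym _ _ qw) (State.qw s ◅ ε))
      resolve s (fwd _)  l l⊆M short ¬wt | yes refl = ⊥-elim (no-fold l short)
      resolve {t = t} s e l l⊆M short ¬wt | no t≢w with dir t w ≟ᵇ true | bi t w ≟ᵇ true
      resolve s (bwd _) l l⊆M short ¬wt | no t≢w | yes tw | _ = ⊥-elim (no-shortcut-fwd l short tw)
      resolve s e@(fwd _) l l⊆M short ¬wt | no t≢w | yes tw | _ = advance s e l l⊆M short tw
      resolve s e@(bid _) l l⊆M short ¬wt | no t≢w | yes tw | _ = advance s e l l⊆M short tw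
      resolve s (bwd tq) l l⊆M short ¬wt | no t≢w | no _ | yes tw =
        ⊥-elim (ancestral _ _ (bi-sym _ _ tw) (tq ◅ State.qw s ◅ ε))
      resolve s (fwd _) l l⊆M short ¬wt | no t≢w | no _ | yes tw = ⊥-elim (no-shortcut-bid l short tw)
      resolve s (bid _) l l⊆M short ¬wt | no t≢w | no _ | yes tw = ⊥-elim (no-shortcut-bid l short tw)
      resolve s e l l⊆M short ¬wt | no t≢w | no ¬tw | no ¬bi =
        detected s e (l⊆M (∈-verts-head l)) t≢w [ ¬tw , [ ¬wt , ¬bi ]′ ]′

      advance {t = t} s e l l⊆M short tw with t ∈? C
      ... | no t∉ = ⊥-elim (no-shortcut-fwd (forget-mark t∉ l)
                      (subst (λ m → suc (suc (m + len r)) ≤ L) (sym (len-forget-mark t∉ l)) short) tw)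
      advance s e stop l⊆M short tw | yes t∈ = contradiction t∈ a∉
      advance (state X g fence k∈X X⊆M _) e (go o e′ l) l⊆M short tw | yes t∈ with ∈-collider t∈ o
      ... | _ , refl =
        resolve
          (state _ (hub (grow acyc g e)) (fence-grow fence e tw) (p⊆p∪q _ k∈X)
            (extend-⊆M X⊆M (l⊆M (here refl))) tw)
          e′ l (l⊆M ∘ there) (≤-trans (n≤1+n _) short) (no-back tw e′)

    module _ {a b : Fin n} (a∉ : a ∉ C) (b∉ : b ∉ C) (a≢b : a ≢ b) (min : NoShorter {C} a b L) where

      -- A neighbour towards which `k` has a tail ends the discriminating path; the search runs
      -- through the other neighbour.
      noncollider-witness : ∀ {m p m′ p′ k u w} → Status (_∈ C) C m k m′ → k ∉ C → M k →
        Link m p k u → (l : Strict C p u a) → (∀ {x} → x ∈ˡ verts l → M x) →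
        Link m′ p′ k w → (r : Strict C p′ w b) → (∀ {x} → x ∈ˡ verts r → M x) →
        suc (suc (len l + len r)) ≤ L → Witness M k
      noncollider-witness {k = k} {u} {w} o k∉ k∈M e l l⊆M e′ r r⊆M short = oriented o e l l⊆M e′ r r⊆M short
        where
        min′ : NoShorter b a L
        min′ = no-shorter-sym a∉ a≢b min

        rightward : ∀ {m p} → Link m p k u → (l : Strict C p u a) → (∀ {x} → x ∈ˡ verts l → M x) →
          dir k w ≡ true → (r : Strict C true w b) → (∀ {x} → x ∈ˡ verts r → M x) →
          suc (suc (len l + len r)) ≤ L → ¬ (dir w u ≡ true) → Witness M k
        rightward e l l⊆M kw r r⊆M short ¬wu = N.resolve N.start e l l⊆M short ¬wu
          where module N = Noncollider a∉ min kw k∈M (r⊆M (∈-verts-head r)) r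

        leftward : ∀ {m p} → Link m p k w → (r : Strict C p w b) → (∀ {x} → x ∈ˡ verts r → M x) →
          dir k u ≡ true → (l : Strict C true u a) → (∀ {x} → x ∈ˡ verts l → M x) →
          suc (suc (len l + len r)) ≤ L → ¬ (dir u w ≡ true) → Witness M k
        leftward e r r⊆M ku l l⊆M short ¬uw =
          N.resolve N.start e r r⊆M (subst (λ m → suc (suc m) ≤ L) (+-comm (len l) (len r)) short) ¬uw
          where module N = Noncollider b∉ min′ ku k∈M (l⊆M (∈-verts-head l)) l

        oriented : ∀ {m p m′ p′} → Status (_∈ C) C m k m′ →
          Link m p k u → (l : Strict C p u a) → (∀ {x} → x ∈ˡ verts l → M x) →
          Link m′ p′ k w → (r : Strict C p′ w b) → (∀ {x} → x ∈ˡ verts r → M x) →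
          suc (suc (len l + len r)) ≤ L → Witness M k
        oriented (collider k∈) = contradiction k∈ k∉
        oriented (tailˡ _) (fwd ku) l l⊆M (bwd wk) r r⊆M short =
          leftward (bwd wk) r r⊆M ku l l⊆M short (λ uw → acyc _ _ uw (wk ◅ ku ◅ ε))
        oriented (tailˡ _) (fwd ku) l l⊆M (bid kw) r r⊆M short =
          leftward (bid kw) r r⊆M ku l l⊆M short (λ uw → ancestral _ _ (bi-sym _ _ kw) (ku ◅ uw ◅ ε))
        -- With tails on both sides, the chosen neighbour must not point to the other one; by
        -- acyclicity one of the choices works.
        oriented (tailˡ _) (fwd ku) l l⊆M (fwd kw) r r⊆M short with dir w u ≟ᵇ true
        ... | no ¬wu = rightward (fwd ku) l l⊆M kw r r⊆M short ¬wu
        ... | yes wu = leftward (fwd kw) r r⊆M ku l l⊆M short (λ uw → acyc _ _ uw (wu ◅ ε))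
        oriented (tailʳ _) (fwd ku) l l⊆M (fwd kw) r r⊆M short with dir w u ≟ᵇ true
        ... | no ¬wu = rightward (fwd ku) l l⊆M kw r r⊆M short ¬wu
        ... | yes wu = leftward (fwd kw) r r⊆M ku l l⊆M short (λ uw → acyc _ _ uw (wu ◅ ε))
        oriented (tailʳ _) (bwd uk) l l⊆M (fwd kw) r r⊆M short =
          rightward (bwd uk) l l⊆M kw r r⊆M short (λ wu → acyc _ _ wu (uk ◅ kw ◅ ε))
        oriented (tailʳ _) (bid ku) l l⊆M (fwd kw) r r⊆M short =
          rightward (bid ku) l l⊆M kw r r⊆M short (λ wu → ancestral _ _ (bi-sym _ _ ku) (kw ◅ wu ◅ ε))

      private
        scan : ∀ {m p u v} → Link m p v u → (l : Strict C p u a) → (∀ {x} → x ∈ˡ verts l → M x) →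
          (r : Strict C m v b) → (∀ {x} → x ∈ˡ verts r → M x) → suc (len l + len r) ≤ L →
          ∀ {x} → x ∈ˡ verts r → x ∉ C → x ≡ b ⊎ Witness M x
        scan e l l⊆M stop r⊆M short (here refl) x∉ = inj₁ refl
        scan e l l⊆M (go o e′ r) r⊆M short (here refl) x∉ =
          inj₂ (noncollider-witness o x∉ (r⊆M (here refl)) e l l⊆M e′ r (r⊆M ∘ there)
                 (subst (λ m → suc m ≤ L) (+-suc (len l) (len r)) short))
        scan e l l⊆M (go o e′ r) r⊆M short (there i) x∉ =
          scan (link-flip e′) (go (Status-swap o) e l) (λ { (here refl) → r⊆M (here refl) ; (there j) → l⊆M j })
            r (r⊆M ∘ there) (subst (λ m → suc m ≤ L) (+-suc (len l) (len r)) short) i x∉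

      shortest-witness : (t : Strict C false a b) → len t ≤ L → (∀ {x} → x ∈ˡ verts t → M x) →
        ∀ {x} → x ∈ˡ verts t → x ∉ C → x ≡ a ⊎ x ≡ b ⊎ Witness M x
      shortest-witness stop       short t⊆M (here refl) x∉ = inj₁ refl
      shortest-witness (go o e t) short t⊆M (here refl) x∉ = inj₁ refl
      shortest-witness (go o e t) short t⊆M (there i)   x∉ =
        inj₂ (scan (link-flip e) stop (λ { (here refl) → t⊆M (here refl) }) t (t⊆M ∘ there) short i x∉)

-- Transfer of separations between MAGs with equal parametrizing sets.

module _ {n : ℕ} {G₁ G₂ : ADMG n} (mag₁ : IsMAG G₁) (mag₂ : IsMAG G₂) where

  private
    acyc₁ = proj₁ mag₁
    acyc₂ = proj₁ mag₂

  module _ (S₂⇒S₁ : ∀ W → InS G₂ W → InS G₁ W) (S₁⇒S₂ : ∀ W → InS G₁ W → InS G₂ W)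
           {a b : Fin n} {C : Subset n} (a∉ : a ∉ C) (b∉ : b ∉ C) (a≢b : a ≢ b) where

    private
      Near₁ : Fin n → Set
      Near₁ = Near G₁ a b C

      near? : Decidable₁ Near₁
      near? v = anc? G₁ v a ⊎-dec (anc? G₁ v b ⊎-dec inAn? G₁ C v)

      near-step : ∀ {u v} → Anc G₁ u v → Near₁ v → Near₁ u
      near-step p = Sum.map (p ◅◅_) (Sum.map (p ◅◅_) (inAn-step G₁ p))

      inS-pair⇒adjacent : ∀ {k w} → k ≢ w → InS G₁ (⁅ k ⁆ ∪ ⁅ w ⁆) → ¬ ¬ Adjacent G₁ k w
      inS-pair⇒adjacent {k} {w} k≢w inS nonadj with proj₁ (proj₂ mag₁) k w k≢w nonadj
      ... | D , k∉ , w∉ , sep =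
        inS⇒connected G₁ acyc₁ inS (p⊆p∪q _ (x∈⁅x⁆ k)) ∈-insert k∉
          (λ x x∈ → Sum.map (x∈⁅y⁆⇒x≡y k) inj₁ (∈-insert⁻ x∈)) (sep k w (x∈⁅x⁆ k) (x∈⁅x⁆ w))

      -- Were k not in an(abC) in G₁, it would be barren in X ∪ {w}, and extending X through k
      -- would give a set in S(G₁) that is not in S(G₂).
      witness-near : ∀ {M : Fin n → Set} {k} → Witness G₂ M k →
        (∀ {x} → M x → Anc G₁ k x → x ≢ k → Near₁ x) → ¬ ¬ Near₁ k
      witness-near {k = k} (witness X w k∈X X⊆M w∈M k≢w edge inS notInS) later far =
        inS-pair⇒adjacent k≢w (S₂⇒S₁ _ edge)
          [ (λ kw → k≢w (sym (barren w∈M (kw ◅ ε))))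
          , [ (λ wk → adjoin (inj₁ wk)) , (λ kw → adjoin (inj₂ (ADMG.bi-sym G₁ _ _ kw))) ]′ ]′
        where
        barren : ∀ {x} → _ → Anc G₁ k x → x ≡ k
        barren {x} x∈M p = decidable-stable (x ≟ k) (λ x≢k → far (near-step p (later x∈M p x≢k)))

        adjoin : Into G₁ w k → ⊥
        adjoin w→k = notInS (S₁⇒S₂ _ (inS-extend G₁ acyc₁ (S₂⇒S₁ _ inS) k∈X (λ x x∈ → barren (X⊆M x∈)) w→k))

      -- The induction runs over descendants in `G₁`: when `v` is treated, its proper descendants on
      -- the trail are already known to be in an(a, b, C).
      shortest-near : ∀ {L} → NoShorter G₂ a b L → (t : Strict G₂ C false a b) → len G₂ t ≤ L →
        ∀ {v} → v ∈ˡ verts G₂ t → Near₁ v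
      shortest-near min t short {v} = by-descendants v (⊏-noetherian G₁ acyc₁ v)
        where
        by-descendants : ∀ v → Acc (flip (_⊏_ G₁ acyc₁)) v → v ∈ˡ verts G₂ t → Near₁ v
        by-descendants v (acc rec) v∈ with v ∈? C
        ... | yes v∈C = inj₂ (inj₂ (inAn-self G₁ v∈C))
        ... | no v∉C with shortest-witness G₂ mag₂ (_∈ˡ verts G₂ t) a∉ b∉ a≢b min t short (λ i → i) v∈ v∉C
        ... | inj₁ refl        = inj₁ ε
        ... | inj₂ (inj₁ refl) = inj₂ (inj₁ ε)
        ... | inj₂ (inj₂ wit)  = decidable-stable (near? v)
          (witness-near wit (λ x∈ p x≢v → by-descendants _ (rec (p , x≢v)) x∈))

      Linked₁ : Fin n → Fin n → Set
      Linked₁ = Linked G₁ Near₁ C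

      inS-linked : ∀ {X x y} → InS G₂ X → (∀ {v} → v ∈ X → Near₁ v) → x ∈ X → y ∈ X → x ∉ C → Linked₁ x y
      inS-linked inS X-near x∈ y∈ x∉ with InS⇒hub G₁ (S₂⇒S₁ _ inS)
      ... | q , h = hub-linked G₁ (λ (c , c∈ , p) → near-step p (X-near c∈)) h x∈ y∈ x∉

      -- Consecutive noncolliders of a strict trail in G₂ lie, with the colliders between them, in
      -- a set of S(G₂) = S(G₁), and are therefore linked in G₁.
      link-all : ∀ {h v} → v ∉ C → (t : Strict G₂ C h v b) → (∀ {x} → x ∈ˡ verts G₂ t → Near₁ x) → Linked₁ v b

      link-from : ∀ {x m p q y X} → x ∉ C → x ∈ X → (∀ {v} → v ∈ X → Near₁ v) → Growing G₂ m X q →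
        Link G₂ m p q y → (t : Strict G₂ C p y b) → (∀ {v} → v ∈ˡ verts G₂ t → Near₁ v) → Linked₁ x b

      link-all v∉ stop       near h = stop
      link-all v∉ (go o e t) near =
        link-from v∉ (x∈⁅x⁆ _) (λ x∈ → subst Near₁ (sym (x∈⁅y⁆⇒x≡y _ x∈)) (near (here refl))) seed e t (near ∘ there)

      link-from {y = y} {X} x∉ x∈ X-near g e t near with y ∈? C
      ... | no y∉ = λ h → _⋯_ G₁ (inS-linked (grow-inS G₂ acyc₂ g e) X∪y-near (p⊆p∪q _ x∈) ∈-insert x∉ h)
                              (link-all y∉ t near)
        where
        X∪y-near : ∀ {v} → v ∈ X ∪ ⁅ y ⁆ → Near₁ v
        X∪y-near v∈ = [ X-near , (λ { refl → near (∈-verts-head G₂ t) }) ]′ (∈-insert⁻ v∈)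
      link-from x∉ x∈ X-near g e stop near | yes y∈ = contradiction y∈ b∉
      link-from x∉ x∈ X-near g e (go o e′ t) near | yes y∈ with ∈-collider y∈ o
      ... | refl , refl =
        link-from x∉ (p⊆p∪q _ x∈)
          (λ v∈ → [ X-near , (λ { refl → near (here refl) }) ]′ (∈-insert⁻ v∈))
          (hub (grow G₂ acyc₂ g e)) e′ t (near ∘ there)

    separated-transfer : NoPath G₁ a b C → ¬ Strict G₂ C false a b
    separated-transfer sep t = no-trail t (<-wellFounded (len G₂ t))
      where
      no-trail : (t : Strict G₂ C false a b) → Acc _<_ (len G₂ t) → ⊥
      -- The induction hypothesis rules out every shorter trail, so `t` counts as shortest.
      no-trail t (acc rec) = separated⇒no-trail G₁ acyc₁ sep
        (link-all a∉ t (shortest-near (λ s lt → no-trail s (rec lt)) t ≤-refl) false)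

-- The two implications.

inS-equal⇒msep : ∀ {n} {G₁ G₂ : ADMG n} → IsMAG G₁ → IsMAG G₂ → (∀ W → InS G₁ W ⇔ InS G₂ W) →
  ∀ {A B C} → Disjoint A B → Disjoint A C → Disjoint B C → MSep G₁ A B C → MSep G₂ A B C
inS-equal⇒msep {G₂ = G₂} mag₁ mag₂ S≡ {C = C} A#B A#C B#C sep a b a∈ b∈ w (_ , oks) =
  separated-transfer mag₁ mag₂ (λ W → Equivalence.from (S≡ W)) (λ W → Equivalence.to (S≡ W))
    (A#C a a∈) (B#C b b∈) (λ { refl → A#B a a∈ b∈ })
    (sep a b a∈ b∈) (strict G₂ (fromPath G₂ (A#C a a∈) w oks))

-- A vertex `h` barren in `W` for `G₂` serves as hub. If it missed some `x`, the separation of `h`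
-- from `x` in `G₂` would carry over to `G₁`, although its separating set contains the rest of `W`.
equivalent⇒inS : ∀ {n} {G₁ G₂ : ADMG n} → Acyclic G₁ → Acyclic G₂ → MarkovEquivalent G₁ G₂ →
  ∀ W → InS G₁ W → InS G₂ W
equivalent⇒inS {G₁ = G₁} {G₂} acyc₁ acyc₂ equiv W inS with InS⇒hub G₁ inS
... | _ , (_ , w∈ , _) , _ with barren-descendant G₂ acyc₂ w∈
... | h , bar@(h∈ , _) , _ = hub⇒InS G₂ acyc₂ (h , inAn-self G₂ h∈ , touch)
  where
  touch : ∀ x → x ∈ W → Touches G₂ (InAn G₂ W) h x
  touch x x∈ = decidable-stable (touches? G₂ (inAn? G₂ W) h x) connected
    where
    connected : ¬ ¬ Touches G₂ (InAn G₂ W) h x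
    connected apart = inS⇒connected G₁ acyc₁ inS h∈ x∈ h∉ cover separated₁
      where
      D = rest-of-an G₂ acyc₂ bar x∈ apart
      h∉ = h∉rest G₂ acyc₂ bar x∈ apart
      x≢h = untouched⇒≢ G₂ acyc₂ bar x∈ apart

      separated₂ : MSep G₂ ⁅ h ⁆ ⁅ x ⁆ D
      separated₂ u v u∈ v∈ with x∈⁅y⁆⇒x≡y h u∈ | x∈⁅y⁆⇒x≡y x v∈
      ... | refl | refl = untouched⇒separated G₂ acyc₂ bar x∈ apart

      separated₁ : NoPath G₁ h x D
      separated₁ = Equivalence.from
        (equiv ⁅ h ⁆ ⁅ x ⁆ D (h , x∈⁅x⁆ h) (x , x∈⁅x⁆ x)
          (λ v v∈h v∈x → x≢h (trans (sym (x∈⁅y⁆⇒x≡y x v∈x)) (x∈⁅y⁆⇒x≡y h v∈h)))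
          (λ v v∈h → subst (_∉ D) (sym (x∈⁅y⁆⇒x≡y h v∈h)) h∉)
          (λ v v∈x → subst (_∉ D) (sym (x∈⁅y⁆⇒x≡y x v∈x)) (x∉rest G₂ acyc₂ bar x∈ apart)))
        separated₂ h x (x∈⁅x⁆ h) (x∈⁅x⁆ x)

      cover : ∀ v → v ∈ W → v ≡ h ⊎ v ≡ x ⊎ v ∈ D
      cover v v∈ with v ≟ h | v ≟ x
      ... | yes v≡h | _       = inj₁ v≡h
      ... | no _    | yes v≡x = inj₂ (inj₁ v≡x)
      ... | no v≢h  | no v≢x  = inj₂ (inj₂ (∈-rest G₂ acyc₂ bar x∈ apart (inAn-self G₂ v∈) v≢h v≢x))

markov-sym : ∀ {n} {G₁ G₂ : ADMG n} → MarkovEquivalent G₁ G₂ → MarkovEquivalent G₂ G₁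
markov-sym equiv A B C neA neB A#B A#C B#C = ⇔-sym (equiv A B C neA neB A#B A#C B#C)

theorem3p2 : (n : ℕ) (G₁ G₂ : ADMG n) → IsMAG G₁ → IsMAG G₂ →
    MarkovEquivalent G₁ G₂ ⇔ (∀ (W : Subset n) → InS G₁ W ⇔ InS G₂ W)
theorem3p2 n G₁ G₂ mag₁@(acyc₁ , _) mag₂@(acyc₂ , _) = mk⇔
  (λ equiv W → mk⇔ (equivalent⇒inS acyc₁ acyc₂ equiv W)
                   (equivalent⇒inS acyc₂ acyc₁ (markov-sym {G₁ = G₁} {G₂} equiv) W))
  (λ S≡ A B C _ _ A#B A#C B#C → mk⇔ (inS-equal⇒msep mag₁ mag₂ S≡ A#B A#C B#C)
                                    (inS-equal⇒msep mag₂ mag₁ (λ W → ⇔-sym (S≡ W)) A#B A#C B#C))
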